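{- Let $a\ge 2$ be an even integer. For every integer $n\ge 1$, the generalized Fermat number $F_n^{(a)}=a^{2^{n-1}}+1$ is primover to base $a$.
   Context: For an integer $a>1$ and an odd integer $n>1$ with $\gcd(a,n)=1$: $h_a(n)$ denotes the multiplicative order of $a$ modulo $n$. A cyclotomic coset of $a$ modulo $n$ is a set of the form $\{\, s a^j \bmod n : j\ge 0\,\}$ with $s\in\{1,\dots,n-1\}$; these cosets partition $\{1,\dots,n-1\}$, and $r_a(n)$ denotes the number of distinct cyclotomic cosets of $a$ modulo $n$. An odd composite number $n$ coprime to $a$ is called an overpseudoprime to base $a$ if $n=r_a(n)\,h_a(n)+1$. An integer $N>1$ is called primover to base $a$ if it is either prime or an overpseudoprime to base $a$. -}

module Defs where

open import Data.Fin.Base using (Fin)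
open import Data.Nat.Base using (ℕ; _+_; _*_; _∸_; _^_; _≤_; _<_; _%_; NonZero)
open import Data.Nat.Coprimality using (Coprime)
open import Data.Nat.Divisibility using (_∤_)
open import Data.Nat.Primality using (Prime; Composite; composite⇒nonZero)
open import Data.Product.Base using (∃; _×_; proj₁)
open import Data.Sum.Base using (_⊎_)
open import Function.Bundles using (Bijection)
open import Level using (0ℓ; suc)
open import Relation.Binary.Bundles using (Setoid)
import Relation.Binary.Construct.On as On
open import Relation.Binary.PropositionalEquality using (_≡_; setoid)
open import Relation.Unary using (Pred; _≐_)
open import Relation.Unary.Relation.Binary.Equality using (≐-setoid)

-- h = h_a(n), given as its graph: leastness makes h unique.
record IsMultiplicativeOrder (a n : ℕ) .{{_ : NonZero n}} (h : ℕ) : Set where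
  field
    positive : 1 ≤ h
    power≡1  : (a ^ h) % n ≡ 1 % n
    least    : ∀ k → 1 ≤ k → (a ^ k) % n ≡ 1 % n → h ≤ k

Coset : (a n : ℕ) .{{_ : NonZero n}} (s : ℕ) → Pred ℕ 0ℓ
Coset a n s x = ∃ λ j → x ≡ (s * a ^ j) % n

IsCyclotomicCoset : (a n : ℕ) .{{_ : NonZero n}} → Pred ℕ 0ℓ → Set
IsCyclotomicCoset a n C = ∃ λ s → 1 ≤ s × s < n × C ≐ Coset a n s

-- Two cosets count as the same when they have the same elements, whatever
-- generator s was used to exhibit them.
CyclotomicCosets : (a n : ℕ) .{{_ : NonZero n}} → Setoid (suc 0ℓ) 0ℓ
CyclotomicCosets a n = On.setoid (≐-setoid ℕ 0ℓ) (proj₁ {B = IsCyclotomicCoset a n})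

-- r = r_a(n), given as its graph: r is the cardinality of the setoid of cosets.
IsCosetCount : (a n : ℕ) .{{_ : NonZero n}} (r : ℕ) → Set₁
IsCosetCount a n r = Bijection (setoid (Fin r)) (CyclotomicCosets a n)

record Overpseudoprime (a n : ℕ) : Set₁ where
  field
    odd       : 2 ∤ n
    composite : Composite n
    coprime   : Coprime a n

  private instance
    n≢0 : NonZero n
    n≢0 = composite⇒nonZero composite

  field
    {h r}    : ℕ
    isOrder  : IsMultiplicativeOrder a n h
    isCount  : IsCosetCount a n r
    equation : n ≡ r * h + 1

Primover : (a N : ℕ) → Set₁
Primover a N = 1 < N × (Prime N ⊎ Overpseudoprime a N)

generalizedFermat : (a n : ℕ) → ℕ
generalizedFermat a n = a ^ (2 ^ (n ∸ 1)) + 1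

{-# OPTIONS --safe #-}

-- Put M = a ^ 2 ^ m, N = M + 1 and h = 2 ^ (m + 1), so that a ^ h ≡ 1 (mod N).
-- Suppose s * a ^ d ≡ s for some 0 < d < h.  Some multiple of d has the form
-- 2 ^ m * (odd), and a to that exponent is ≡ M ≡ -1, hence 2 s ≡ 0, and s ≡ 0
-- because N is odd.  So multiplication by a acts on the nonzero residues with
-- all orbits of length h: h is the order of a, and the number r of cosets
-- satisfies N - 1 = r * h.
module Submission where

open import Defs
open import Data.Nat.Base using (ℕ; _≤_)
open import Data.Nat.Divisibility using (_∣_)

open import Data.Fin.Base as Fin using (Fin; toℕ; fromℕ<; combine; remQuot)
open import Data.Fin.Properties using (any?; toℕ<n; toℕ-fromℕ<; toℕ-injective; combine-injective; combine-remQuot; cantor-schröder-bernstein)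
open import Data.Nat.Base using (zero; suc; pred; _+_; _*_; _∸_; _^_; _/_; _%_; _<_; z≤n; s≤s; NonZero; n>1⇒nonTrivial; >-nonZero; >-nonZero⁻¹)
open import Data.Nat.Coprimality using (Coprime)
open import Data.Nat.Divisibility using (_∤_; divides; ∣m+n∣m⇒∣n; ∣1⇒≡1; ∣-trans; m∣m*n; ∣⇒≤; m%n≡0⇒n∣m)
open import Data.Nat.DivMod using (%-distribˡ-*; %-distribˡ-+; m%n%n≡m%n; m%n<n; m<n⇒m%n≡m; m≡m%n+[m/n]*n; [m+kn]%n≡m%n; m*n%n≡0)
open import Data.Nat.Primality using (prime?; ¬prime⇒composite)
open import Data.Nat.Properties
open import Data.Nat.Tactic.RingSolver using (solve-∀)
open import Data.Product.Base using (∃; ∃₂; _×_; _,_; proj₁; proj₂; uncurry)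
open import Data.Sum.Base using (_⊎_; inj₁; inj₂)
open import Function.Base using (_∘_)
open import Level using (Level)
open import Relation.Binary.Core using (Rel)
open import Relation.Binary.Definitions using (Reflexive; Symmetric; Decidable; tri<; tri≈; tri>)
open import Relation.Binary.PropositionalEquality using (_≡_; refl; sym; trans; cong; cong₂; subst; module ≡-Reasoning)
open import Relation.Nullary using (¬_; Dec; yes; no; contradiction)
open import Relation.Nullary.Decidable using (map′)
open import Relation.Unary using (_≐_)

private
  variable
    ℓ : Level
    k n s t x : ℕ

-- Systems of representatives in finite sets

record Transversal {n : ℕ} (R : Rel (Fin n) ℓ) : Set ℓ where
  field
    size      : ℕ
    rep       : Fin size → Fin n
    covers    : ∀ x → ∃ λ i → R (rep i) x
    separates : ∀ i j → R (rep i) (rep j) → i ≡ j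

-- Greedy choice by induction on `n`: representatives for the nonzero elements are kept, and `zero`
-- joins them exactly when it is related to none.
transversal : {R : Rel (Fin n) ℓ} → Reflexive R → Symmetric R → Decidable R → Transversal R
transversal {n = zero} _ _ _ = record
  { size = 0 ; rep = λ () ; covers = λ () ; separates = λ () }
transversal {n = suc n} {R = R} R-refl R-sym R? = extend (any? λ i → R? (Fin.suc (rep i)) Fin.zero)
  where
  open Transversal (transversal {R = λ x y → R (Fin.suc x) (Fin.suc y)} R-refl R-sym (λ x y → R? (Fin.suc x) (Fin.suc y)))

  extend : Dec (∃ λ i → R (Fin.suc (rep i)) Fin.zero) → Transversal R
  extend (yes (i , i~0)) = record
    { size      = size
    ; rep       = Fin.suc ∘ rep
    ; covers    = λ { Fin.zero → i , i~0 ; (Fin.suc x) → covers x }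
    ; separates = separates
    }
  extend (no ∄i~0) = record
    { size      = suc size
    ; rep       = λ { Fin.zero → Fin.zero ; (Fin.suc i) → Fin.suc (rep i) }
    ; covers    = λ { Fin.zero → Fin.zero , R-refl
                    ; (Fin.suc x) → Fin.suc (proj₁ (covers x)) , proj₂ (covers x) }
    ; separates = λ { Fin.zero    Fin.zero    _   → refl
                    ; Fin.zero    (Fin.suc j) 0~j → contradiction (j , R-sym 0~j) ∄i~0
                    ; (Fin.suc i) Fin.zero    i~0 → contradiction (i , i~0) ∄i~0
                    ; (Fin.suc i) (Fin.suc j) i~j → cong Fin.suc (separates i j i~j) }
    }

-- Congruences modulo `n` and orbits under multiplication by `a`

module _ (a n : ℕ) .{{_ : NonZero n}} where

  infix 4 _≈_

  _≈_ : ℕ → ℕ → Set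
  x ≈ y = x % n ≡ y % n

  *-congʳ-≈ : ∀ {x y} z → x ≈ y → x * z ≈ y * z
  *-congʳ-≈ {x} {y} z x≈y = begin
    x * z % n             ≡⟨ %-distribˡ-* x z n ⟩
    (x % n) * (z % n) % n ≡⟨ cong (λ u → u * (z % n) % n) x≈y ⟩
    (y % n) * (z % n) % n ≡⟨ %-distribˡ-* y z n ⟨
    y * z % n             ∎
    where open ≡-Reasoning

  *-congˡ-≈ : ∀ {x y} z → x ≈ y → z * x ≈ z * y
  *-congˡ-≈ {x} {y} z x≈y rewrite *-comm z x | *-comm z y = *-congʳ-≈ z x≈y

  *^-+ : ∀ s i j → s * a ^ (i + j) ≡ s * a ^ i * a ^ j
  *^-+ s i j = trans (cong (s *_) (^-distribˡ-+-* a i j)) (sym (*-assoc s (a ^ i) (a ^ j)))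

  shift-≈ : ∀ s {t} i j → s * a ^ i ≈ t → s * a ^ (i + j) ≈ t * a ^ j
  shift-≈ s i j eq = trans (cong (_% n) (*^-+ s i j)) (*-congʳ-≈ (a ^ j) eq)

  -- Applied both to the exponent `h`, which fixes every `s`, and to a hypothetical shorter period
  -- `d` that is to be refuted.
  fixed-by-multiples : ∀ s {d} → s * a ^ d ≈ s → ∀ k → s * a ^ (k * d) ≈ s
  fixed-by-multiples s     fix zero    = cong (_% n) (*-identityʳ s)
  fixed-by-multiples s {d} fix (suc k) = trans (shift-≈ s d (k * d) fix) (fixed-by-multiples s fix k)

  coset-refl : s < n → Coset a n s s
  coset-refl {s} s<n = 0 , sym (trans (cong (_% n) (*-identityʳ s)) (m<n⇒m%n≡m s<n))

  coset-trans : ∀ s t → Coset a n s t → Coset a n t x → Coset a n s x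
  coset-trans s t (i , t≡) (j , x≡) = i + j , trans x≡ (sym (shift-≈ s i j s*aⁱ≈t))
    where
    s*aⁱ≈t : s * a ^ i ≈ t
    s*aⁱ≈t = sym (trans (cong (_% n) t≡) (m%n%n≡m%n (s * a ^ i) n))

  coset<n : ∀ s → Coset a n s t → t < n
  coset<n s (j , t≡) = subst (_< n) (sym t≡) (m%n<n (s * a ^ j) n)

  -- Cosets when `a ^ h` is 1 modulo `n`

  module OfExponent (h : ℕ) .{{_ : NonZero h}} (aʰ≈1 : a ^ h ≈ 1) where

    *^h≈ : ∀ s → s * a ^ h ≈ s
    *^h≈ s = trans (*-congˡ-≈ s aʰ≈1) (cong (_% n) (*-identityʳ s))

    *^-%h : ∀ s j → s * a ^ j ≈ s * a ^ (j % h)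
    *^-%h s j = begin
      s * a ^ j % n                           ≡⟨ cong (λ e → s * a ^ e % n) (m≡m%n+[m/n]*n j h) ⟩
      s * a ^ (j % h + j / h * h) % n         ≡⟨ shift-≈ s (j % h) (j / h * h) refl ⟩
      s * a ^ (j % h) * a ^ (j / h * h) % n   ≡⟨ fixed-by-multiples (s * a ^ (j % h)) (*^h≈ (s * a ^ (j % h))) (j / h) ⟩
      s * a ^ (j % h) % n                     ∎
      where open ≡-Reasoning

    -- Multiplication by `a ^ (j * pred h)` undoes multiplication by `a ^ j`, because the exponents
    -- add up to `j * h`.
    coset-sym : ∀ s → s < n → Coset a n s t → Coset a n t s
    coset-sym {t} s s<n (j , t≡) = j * pred h , (begin
      s                               ≡⟨ m<n⇒m%n≡m s<n ⟨
      s % n                           ≡⟨ fixed-by-multiples s (*^h≈ s) j ⟨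
      s * a ^ (j * h) % n             ≡⟨ cong (λ e → s * a ^ e % n) (trans (cong (j *_) (sym (suc-pred h))) (*-suc j (pred h))) ⟩
      s * a ^ (j + j * pred h) % n    ≡⟨ shift-≈ s j (j * pred h) (sym (trans (cong (_% n) t≡) (m%n%n≡m%n (s * a ^ j) n))) ⟩
      t * a ^ (j * pred h) % n        ∎)
      where open ≡-Reasoning

    coset-≐ : ∀ s t → s < n → Coset a n s t → Coset a n s ≐ Coset a n t
    coset-≐ s t s<n st = coset-trans t s (coset-sym s s<n st) , coset-trans s t st

    coset-positive : ∀ s → 1 ≤ s → s < n → Coset a n s t → 1 ≤ t
    coset-positive {suc _} s 1≤s s<n st = s≤s z≤n
    -- By symmetry `s` would lie in the coset of 0, whose only element is 0.
    coset-positive {zero}  s 1≤s s<n st =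
      contradiction (trans (proj₂ (coset-sym s s<n st)) (m*n%n≡0 0 n)) (>⇒≢ 1≤s)

    -- Exponents matter only modulo `h`, so membership in a coset reduces to a finite search; this
    -- is what makes it decidable.
    coset-bounded : ∀ s → Coset a n s t → ∃ λ (j : Fin h) → t ≡ s * a ^ toℕ j % n
    coset-bounded s (j , t≡) = fromℕ< (m%n<n j h) ,
      trans t≡ (trans (*^-%h s j) (cong (λ e → s * a ^ e % n) (sym (toℕ-fromℕ< (m%n<n j h)))))

    coset? : ∀ s t → Dec (Coset a n s t)
    coset? s t = map′ (λ (j , t≡) → toℕ j , t≡) (coset-bounded s) (any? λ j → t ≟ s * a ^ toℕ j % n)

    -- Every nonzero residue has an orbit of full length `h`. The case `s = 1` gives the order of
    -- `a`; all `s` together give the coset count.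
    Free : Set
    Free = ∀ {s d} → 1 ≤ s → s < n → 1 ≤ d → d < h → ¬ s * a ^ d ≈ s

    module _ (free : Free) where

      -- The factor `a ^ i` is cancelled by multiplying both sides by `a ^ (h ∸ i)`, which leaves
      -- `s` fixed by the shorter power `a ^ (j ∸ i)`.
      free⇒≮ : ∀ {s i j} → 1 ≤ s → s < n → j < h → s * a ^ i ≈ s * a ^ j → ¬ i < j
      free⇒≮ {s} {i} {j} 1≤s s<n j<h eq i<j =
        free 1≤s s<n (m<n⇒0<n∸m i<j) (≤-<-trans (m∸n≤m j i) j<h) (begin
          s * a ^ (j ∸ i) % n               ≡⟨ *^h≈ (s * a ^ (j ∸ i)) ⟨
          s * a ^ (j ∸ i) * a ^ h % n       ≡⟨ cong (_% n) (*^-+ s (j ∸ i) h) ⟨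
          s * a ^ (j ∸ i + h) % n           ≡⟨ cong (λ e → s * a ^ e % n) exponents ⟩
          s * a ^ (j + (h ∸ i)) % n         ≡⟨ shift-≈ s j (h ∸ i) (sym eq) ⟩
          s * a ^ i * a ^ (h ∸ i) % n       ≡⟨ cong (_% n) (*^-+ s i (h ∸ i)) ⟨
          s * a ^ (i + (h ∸ i)) % n         ≡⟨ cong (λ e → s * a ^ e % n) (m+[n∸m]≡n i≤h) ⟩
          s * a ^ h % n                     ≡⟨ *^h≈ s ⟩
          s % n                             ∎)
        where
        open ≡-Reasoning
        i≤h = <⇒≤ (<-trans i<j j<h)
        exponents : j ∸ i + h ≡ j + (h ∸ i)
        exponents = trans (sym (+-∸-comm h (<⇒≤ i<j))) (+-∸-assoc j i≤h)

      free⇒injective : ∀ {s i j} → 1 ≤ s → s < n → i < h → j < h → s * a ^ i ≈ s * a ^ j → i ≡ j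
      free⇒injective {s} {i} {j} 1≤s s<n i<h j<h eq with <-cmp i j
      ... | tri< i<j _ _ = contradiction i<j (free⇒≮ 1≤s s<n j<h eq)
      ... | tri≈ _ i≡j _ = i≡j
      ... | tri> _ _ j<i = contradiction j<i (free⇒≮ 1≤s s<n i<h (sym eq))

      free⇒isOrder : 1 < n → IsMultiplicativeOrder a n h
      free⇒isOrder 1<n = record
        { positive = >-nonZero⁻¹ h
        ; power≡1  = aʰ≈1
        ; least    = λ k 1≤k aᵏ≈1 → ≮⇒≥ λ k<h →
            free ≤-refl 1<n 1≤k k<h (trans (cong (_% n) (*-identityˡ (a ^ k))) aᵏ≈1)
        }

      -- Counting the nonzero residues coset by coset

      residue : Fin (pred n) → ℕ
      -- The shift by one makes `Fin (pred n)` index the residues from 1 to `n - 1`.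
      residue x = suc (toℕ x)

      residue<n : ∀ x → residue x < n
      residue<n x = subst (residue x <_) (suc-pred n) (s≤s (toℕ<n x))

      residue-injective : ∀ {x y} → residue x ≡ residue y → x ≡ y
      residue-injective = toℕ-injective ∘ suc-injective

      residue-surjective : 1 ≤ s → s < n → ∃ λ x → residue x ≡ s
      residue-surjective {suc s} _ s<n = fromℕ< s<pred , cong suc (toℕ-fromℕ< s<pred)
        where s<pred = <⇒≤pred s<n

      open Transversal (transversal {R = λ x y → Coset a n (residue x) (residue y)}
        (λ {x} → coset-refl (residue<n x)) (λ {x} → coset-sym (residue x) (residue<n x)) (λ x y → coset? (residue x) (residue y)))

      leader : Fin size → ℕ
      leader = residue ∘ rep

      leader<n : ∀ i → leader i < n
      leader<n = residue<n ∘ rep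

      leader-covers : 1 ≤ s → s < n → ∃ λ i → Coset a n (leader i) s
      leader-covers 1≤s s<n with residue-surjective 1≤s s<n
      ... | x , refl = covers x

      leader-separates : ∀ i j → Coset a n (leader i) t → Coset a n (leader j) t → i ≡ j
      leader-separates {t} i j it jt = separates i j (coset-trans (leader i) t it (coset-sym (leader j) (leader<n j) jt))

      isCosetCount : IsCosetCount a n size
      isCosetCount = record
        { to        = λ i → Coset a n (leader i) , leader i , s≤s z≤n , leader<n i , (λ p → p) , (λ p → p)
        ; cong      = λ { refl → (λ p → p) , (λ p → p) }
        -- Injectivity: if two cosets agree, then `leader j` lies in both, and separation of the
        -- leaders applies.
        ; bijective = (λ {i} {j} (_ , j⊆i) → leader-separates i j (j⊆i (coset-refl (leader<n j))) (coset-refl (leader<n j)))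
                    , surj
        }
        where
        surj : ∀ (C : ∃ (IsCyclotomicCoset a n)) → ∃ λ i → ∀ {z} → z ≡ i → Coset a n (leader z) ≐ proj₁ C
        surj (C , s , 1≤s , s<n , C⊆ , ⊆C) with leader-covers 1≤s s<n
        ... | i , is = i , λ { refl → (λ p → ⊆C (proj₁ i≐s p)) , (λ p → proj₂ i≐s (C⊆ p)) }
          where i≐s = coset-≐ (leader i) s (leader<n i) is

      module _ (i : Fin size) (j : Fin h) where
        private
          j∈i : Coset a n (leader i) (leader i * a ^ toℕ j % n)
          j∈i = toℕ j , refl

          hit : ∃ λ x → residue x ≡ leader i * a ^ toℕ j % n
          hit = residue-surjective (coset-positive (leader i) (s≤s z≤n) (leader<n i) j∈i) (coset<n (leader i) j∈i)

        -- Coordinates on the nonzero residues: `i` selects a coset and `j` a position in it,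
        -- counted from its leader.
        element : Fin (pred n)
        element = proj₁ hit

        residue-element : residue element ≡ leader i * a ^ toℕ j % n
        residue-element = proj₂ hit

      element-injective : ∀ {i i′ j j′} → element i j ≡ element i′ j′ → i ≡ i′ × j ≡ j′
      element-injective {i} {i′} {j} {j′} eq = i≡i′ , toℕ-injective
        (free⇒injective (s≤s z≤n) (leader<n i) (toℕ<n j) (toℕ<n j′)
          (trans values (cong (λ k → leader k * a ^ toℕ j′ % n) (sym i≡i′))))
        where
        values : leader i * a ^ toℕ j % n ≡ leader i′ * a ^ toℕ j′ % n
        values = trans (sym (residue-element i j)) (trans (cong residue eq) (residue-element i′ j′))
        i≡i′ : i ≡ i′
        i≡i′ = leader-separates i i′ (toℕ j , refl) (toℕ j′ , values)

      element-surjective : ∀ x → ∃₂ λ i j → x ≡ element i j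
      element-surjective x with covers x
      ... | i , ix with coset-bounded (leader i) ix
      ...   | j , x≡ = i , j , residue-injective (trans x≡ (sym (residue-element i j)))

      -- Injections in both directions between `Fin (pred n)` and `Fin (size * h)` force equal
      -- cardinalities: `locate` reads off coordinates, and `element` turns them back into a
      -- residue.
      pred≡size*h : pred n ≡ size * h
      pred≡size*h = cantor-schröder-bernstein {f = locate} {g = uncurry element ∘ remQuot h} locate-injective
        λ {k} {l} eq → let (i≡ , j≡) = element-injective eq in
          trans (sym (combine-remQuot {size} h k)) (trans (cong₂ combine i≡ j≡) (combine-remQuot {size} h l))
        where
        locate : Fin (pred n) → Fin (size * h)
        locate x = let (i , j , _) = element-surjective x in combine i j

        locate-injective : ∀ {x y} → locate x ≡ locate y → x ≡ y
        locate-injective {x} {y} eq =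
          let (i , j , x≡) = element-surjective x ; (i′ , j′ , y≡) = element-surjective y
              (i≡ , j≡) = combine-injective i j i′ j′ eq
          in trans x≡ (trans (cong₂ element i≡ j≡) (sym y≡))

      free⇒cosetCount : ∃ λ r → IsCosetCount a n r × n ≡ r * h + 1
      free⇒cosetCount = size , isCosetCount ,
        trans (sym (suc-pred n)) (trans (cong suc pred≡size*h) (+-comm 1 (size * h)))

-- Parity and powers of two

even⊎odd : ∀ n → (∃ λ k → n ≡ 2 * k) ⊎ (∃ λ k → n ≡ 2 * k + 1)
even⊎odd zero    = inj₁ (0 , refl)
even⊎odd (suc n) with even⊎odd n
... | inj₁ (k , refl) = inj₂ (k , +-comm 1 (2 * k))
... | inj₂ (k , refl) = inj₁ (suc k , lemma k)
  where
  lemma : ∀ k → suc (2 * k + 1) ≡ 2 * suc k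
  lemma = solve-∀

-- The bound on `d` allows at most `m` factors 2 in it, and `e` supplies the missing ones. The
-- induction halves `d` and lowers `m` together until `d` is odd.
odd-multiple-of-2^ : ∀ m {d} → 1 ≤ d → d < 2 ^ suc m → ∃₂ λ e k → e * d ≡ 2 ^ m * (2 * k + 1)
odd-multiple-of-2^ m {d} 1≤d d< with even⊎odd d
... | inj₂ (k , refl) = 2 ^ m , k , refl
odd-multiple-of-2^ zero    1≤d d< | inj₁ (zero  , refl) = contradiction 1≤d λ ()
odd-multiple-of-2^ zero    1≤d d< | inj₁ (suc k , refl) = contradiction d< (≤⇒≯ (m≤m*n 2 (suc k)))
odd-multiple-of-2^ (suc m) 1≤d d< | inj₁ (d′ , refl)
  with odd-multiple-of-2^ m (*-cancelˡ-< 2 0 d′ 1≤d) (*-cancelˡ-< 2 d′ (2 ^ suc m) d<)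
... | e , k , eq = e , k , (begin
  e * (2 * d′)                ≡⟨ *-assoc e 2 d′ ⟨
  e * 2 * d′                  ≡⟨ cong (_* d′) (*-comm e 2) ⟩
  2 * e * d′                  ≡⟨ *-assoc 2 e d′ ⟩
  2 * (e * d′)                ≡⟨ cong (2 *_) eq ⟩
  2 * (2 ^ m * (2 * k + 1))   ≡⟨ *-assoc 2 (2 ^ m) (2 * k + 1) ⟨
  2 ^ suc m * (2 * k + 1)     ∎)
  where open ≡-Reasoning

-- In `2 * k ≡ q * n` with `n` odd the quotient `q` must be even, and half of it witnesses the
-- claim.
odd∣2*⇒∣ : 2 ∤ n → n ∣ 2 * k → n ∣ k
odd∣2*⇒∣ {n} {k} 2∤n (divides q 2k≡qn) with even⊎odd q
... | inj₁ (q′ , refl) = divides q′ (*-cancelˡ-≡ k (q′ * n) 2 (trans 2k≡qn (*-assoc 2 q′ n)))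
... | inj₂ (q′ , refl) with even⊎odd n
...   | inj₁ (n′ , refl) = contradiction (m∣m*n n′) 2∤n
...   | inj₂ (n′ , refl) = contradiction (trans 2k≡qn (lemma q′ n′)) (even≢odd k (2 * q′ * n′ + q′ + n′))
  where
  lemma : ∀ q n → (2 * q + 1) * (2 * n + 1) ≡ suc (2 * (2 * q * n + q + n))
  lemma = solve-∀

-- The generalized Fermat numbers

module GeneralizedFermat (a m : ℕ) (2≤a : 2 ≤ a) (2∣a : 2 ∣ a) where

  private
    M N h : ℕ
    M = a ^ (2 ^ m)
    N = M + 1
    h = 2 ^ suc m

    instance
      a≢0 : NonZero a
      a≢0 = >-nonZero (≤-trans (s≤s z≤n) 2≤a)

      N≢0 : NonZero N
      N≢0 = >-nonZero (m≤n+m 1 M)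

      h≢0 : NonZero h
      h≢0 = m^n≢0 2 (suc m)

  1<N : 1 < N
  1<N = +-monoˡ-≤ 1 (m^n>0 a (2 ^ m))

  a∣M : a ∣ M
  a∣M = subst (λ e → a ∣ a ^ e) (suc-pred (2 ^ m) {{m^n≢0 2 m}}) (m∣m*n (a ^ pred (2 ^ m)))

  -- A common divisor of `a` and `N = M + 1` divides `M`, hence 1.
  coprime : Coprime a N
  coprime (d∣a , d∣N) = ∣1⇒≡1 (∣m+n∣m⇒∣n d∣N (∣-trans d∣a a∣M))

  odd : 2 ∤ N
  odd 2∣N = contradiction (coprime (2∣a , 2∣N)) λ ()

  -- Here `a ^ h` is the square of `M`, and `M ^ 2 - 1` factors as `(M - 1) * N`.
  aʰ≡1 : a ^ h % N ≡ 1 % N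
  aʰ≡1 = begin
    a ^ (2 * 2 ^ m) % N      ≡⟨ cong (λ e → a ^ e % N) (*-comm 2 (2 ^ m)) ⟩
    a ^ (2 ^ m * 2) % N      ≡⟨ cong (_% N) (^-*-assoc a (2 ^ m) 2) ⟨
    M ^ 2 % N                ≡⟨ cong (_% N) (square M {{m^n≢0 a (2 ^ m)}}) ⟩
    (1 + pred M * N) % N     ≡⟨ [m+kn]%n≡m%n 1 (pred M) N ⟩
    1 % N                    ∎
    where
    open ≡-Reasoning
    square : ∀ x .{{_ : NonZero x}} → x ^ 2 ≡ 1 + pred x * (x + 1)
    square (suc x) = lemma x
      where
      lemma : ∀ x → suc x * (suc x * 1) ≡ 1 + x * (suc x + 1)
      lemma = solve-∀

  open OfExponent a N h aʰ≡1

  free : Free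
  free {s} {d} 1≤s s<N 1≤d d<h fix with odd-multiple-of-2^ m 1≤d d<h
  -- `N` would divide `s`, although `0 < s < N`.
  ... | e , k , ed≡ = contradiction (∣⇒≤ {{>-nonZero 1≤s}} (odd∣2*⇒∣ odd N∣2s)) (<⇒≱ s<N)
    where
    open ≡-Reasoning

    split : ∀ x k → x * (2 * k + 1) ≡ k * (2 * x) + x
    split = solve-∀

    s*M≈s : s * M % N ≡ s % N
    s*M≈s = begin
      -- The odd multiple `2 ^ m * (2 * k + 1)` equals `k * h + 2 ^ m`; the part `k * h` acts
      -- trivially and the rest contributes `M`.
      s * M % N                           ≡⟨ shift-≈ a N s (k * h) (2 ^ m) (fixed-by-multiples a N s (*^h≈ s) k) ⟨
      s * a ^ (k * h + 2 ^ m) % N         ≡⟨ cong (λ e → s * a ^ e % N) (trans ed≡ (split (2 ^ m) k)) ⟨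
      s * a ^ (e * d) % N                 ≡⟨ fixed-by-multiples a N s fix e ⟩
      s % N                               ∎

    double : ∀ s → 2 * s ≡ s + s
    double = solve-∀

    N∣2s : N ∣ 2 * s
    N∣2s = m%n≡0⇒n∣m (2 * s) N (begin
      2 * s % N                       ≡⟨ cong (_% N) (double s) ⟩
      (s + s) % N                     ≡⟨ %-distribˡ-+ s s N ⟩
      -- One summand `s` is traded for `s * M`, so that the sum becomes the multiple `s * N`.
      (s % N + s % N) % N             ≡⟨ cong (λ u → (u + s % N) % N) s*M≈s ⟨
      (s * M % N + s % N) % N         ≡⟨ %-distribˡ-+ (s * M) s N ⟨
      (s * M + s) % N                 ≡⟨ cong (_% N) (trans (cong (s * M +_) (sym (*-identityʳ s))) (sym (*-distribˡ-+ s M 1))) ⟩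
      s * N % N                       ≡⟨ m*n%n≡0 s N ⟩
      0                               ∎)

  primover : Primover a N
  primover with prime? N
  ... | yes N-prime  = 1<N , inj₁ N-prime
  ... | no  ¬N-prime = 1<N , inj₂ record
    { odd       = odd
    ; composite = ¬prime⇒composite {{n>1⇒nonTrivial 1<N}} ¬N-prime
    ; coprime   = coprime
    ; isOrder   = free⇒isOrder free 1<N
    ; isCount   = proj₁ (proj₂ (free⇒cosetCount free))
    ; equation  = proj₂ (proj₂ (free⇒cosetCount free))
    }

theorem5 : (a : ℕ) → 2 ≤ a → 2 ∣ a → (n : ℕ) → 1 ≤ n → Primover a (generalizedFermat a n)
theorem5 a 2≤a 2∣a n 1≤n = GeneralizedFermat.primover a (n ∸ 1) 2≤a 2∣a
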